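{- Let $\frac{a}{b} < \frac{c}{d}$ be any two non-negative rational numbers written in lowest terms. Then the tree $T\left(\frac{a}{b}, \frac{c}{d}\right)$ contains all rational numbers in the interval $\left[\frac{a}{b}, \frac{c}{d}\right]$.
   Context: All fractions are written in lowest terms with positive denominator. The mediant of two reduced fractions $\frac{p}{q}$ and $\frac{r}{s}$ is the fraction $\frac{p+r}{q+s}$ put in lowest terms. Given two non-negative rational numbers $\frac{a}{b} < \frac{c}{d}$ in lowest terms, define finite sequences (rows) $S_n\left(\frac{a}{b},\frac{c}{d}\right)$, $n \ge 0$, of reduced fractions: $S_0 = \left(\frac{a}{b}, \frac{c}{d}\right)$, and $S_{n+1}$ is obtained from $S_n$ by copying all terms and inserting between every two consecutive terms their (reduced) mediant, where the mediant is computed from the reduced forms of the two terms. The tree $T\left(\frac{a}{b},\frac{c}{d}\right)$ is the collection of all the rows $S_n\left(\frac{a}{b},\frac{c}{d}\right)$, $n\ge 0$; a rational number appears in (is contained in) the tree if it is a term of some row. -}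

module Defs where

open import Data.Integer.Base as ℤ using ()
open import Data.List.Base using (List; []; _∷_)
open import Data.List.Membership.Propositional using (_∈_)
open import Data.Nat.Base as ℕ using (ℕ; zero; suc)
open import Data.Product.Base using (∃-syntax)
open import Data.Rational.Base using (ℚ; ↥_; ↧ₙ_; _/_)

-- A value of ℚ carries its lowest-terms numerator and denominator, and
-- _/_ reduces to lowest terms, so common factors are cancelled at every step.
mediant : ℚ → ℚ → ℚ
mediant p q = (↥ p ℤ.+ ↥ q) / (↧ₙ p ℕ.+ ↧ₙ q)

insertMediants : List ℚ → List ℚ
insertMediants []           = []
insertMediants (p ∷ [])     = p ∷ []
insertMediants (p ∷ q ∷ rs) = p ∷ mediant p q ∷ insertMediants (q ∷ rs)

-- The rows S₀, S₁, S₂, … .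
Tree : Set
Tree = ℕ → List ℚ

T : ℚ → ℚ → Tree
T p q zero    = p ∷ q ∷ []
T p q (suc n) = insertMediants (T p q n)

infix 4 _∈ᵀ_

_∈ᵀ_ : ℚ → Tree → Set
x ∈ᵀ S = ∃[ n ] x ∈ S n

{-# OPTIONS --safe #-}

-- For p < x < q put α = det(p, x) and β = det(x, q), both positive integers.
-- If the mediant m of p and q is reduced by the factor g, then
-- g · det(x, m) = β − α and g · det(m, x) = α − β.  Hence replacing p or q by m,
-- whichever keeps x inside the interval, strictly decreases α + β, whatever
-- g is: the descent towards x is a subtractive Euclidean algorithm and
-- stops exactly when x is a mediant.
module Submission where

open import Defs
open import Data.Integer.Base as ℤ using (ℤ; 0ℤ; +_; +[1+_]; ∣_∣)
import Data.Integer.Properties as ℤ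
open import Data.Integer.Tactic.RingSolver using (solve-∀)
open import Data.List.Base using ([]; _∷_)
open import Data.List.Membership.Propositional using (_∈_)
open import Data.List.Relation.Binary.Infix.Heterogeneous using (Infix; here; there)
open import Data.List.Relation.Binary.Prefix.Heterogeneous using (Prefix; []; _∷_)
open import Data.List.Relation.Unary.Any using (here; there)
open import Data.Nat.Base as ℕ using (ℕ; zero; suc)
import Data.Nat.GCD as ℕ
open import Data.Nat.Induction using (Acc; acc; <-wellFounded)
import Data.Nat.Properties as ℕ
open import Data.Product.Base using (_×_; _,_; ∃-syntax)
open import Data.Rational.Base using (ℚ; 0ℚ; ↥_; ↧_; ↧ₙ_; _≤_; _<_)
open import Data.Rational.Properties using (↥-/; ↧-/; drop-*<*; <-cmp; <-irrefl; <-≤-trans)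
open import Data.Sum.Base using (inj₂)
open import Relation.Binary.Definitions using (tri<; tri≈; tri>)
open import Relation.Binary.PropositionalEquality
  using (_≡_; refl; sym; cong; cong₂; subst; module ≡-Reasoning)
open import Relation.Nullary.Negation using (contradiction)

prefix-∈ : ∀ {A : Set} {x : A} {xs ys} → Prefix _≡_ xs ys → x ∈ xs → x ∈ ys
prefix-∈ (refl ∷ pre) (here eq)  = here eq
prefix-∈ (_    ∷ pre) (there x∈) = there (prefix-∈ pre x∈)

infix-∈ : ∀ {A : Set} {x : A} {xs ys} → Infix _≡_ xs ys → x ∈ xs → x ∈ ys
infix-∈ (here pre)  x∈ = prefix-∈ pre x∈
infix-∈ (there inf) x∈ = there (infix-∈ inf x∈)

insertMediants-prefix : ∀ {xs ys} → Prefix _≡_ xs ys →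
  Prefix _≡_ (insertMediants xs) (insertMediants ys)
insertMediants-prefix []                               = []
insertMediants-prefix {ys = _ ∷ []}    (refl ∷ [])     = refl ∷ []
insertMediants-prefix {ys = _ ∷ _ ∷ _} (refl ∷ [])     = refl ∷ []
insertMediants-prefix (refl ∷ pre@(refl ∷ _))          =
  refl ∷ refl ∷ insertMediants-prefix pre

-- Each mediant depends on two neighbours, so mere inclusion of entries would not survive the next
-- row. A contiguous block does: every adjacent pair in it is adjacent in the whole row.
insertMediants-infix : ∀ {xs ys} → Infix _≡_ xs ys →
  Infix _≡_ (insertMediants xs) (insertMediants ys)
insertMediants-infix (here pre) = here (insertMediants-prefix pre)
insertMediants-infix {ys = _ ∷ []} (there (here [])) = here []
-- Skipping the head of `ys` skips two entries of the new row: that head and the mediant after it.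
insertMediants-infix {ys = _ ∷ _ ∷ _} (there inf) =
  there (there (insertMediants-infix inf))

-- Row 1 of `T p q` starts with row 0 of `T p (mediant p q)`, and both then evolve by
-- `insertMediants`; hence the delay of one row.
T-infixˡ : ∀ p q n → Infix _≡_ (T p (mediant p q) n) (T p q (suc n))
T-infixˡ p q zero    = here (refl ∷ refl ∷ [])
T-infixˡ p q (suc n) = insertMediants-infix (T-infixˡ p q n)

T-infixʳ : ∀ p q n → Infix _≡_ (T (mediant p q) q n) (T p q (suc n))
T-infixʳ p q zero    = there (here (refl ∷ refl ∷ []))
T-infixʳ p q (suc n) = insertMediants-infix (T-infixʳ p q n)

∈ᵀ-left : ∀ {x} p q → x ∈ᵀ T p (mediant p q) → x ∈ᵀ T p q
∈ᵀ-left p q (n , x∈) = suc n , infix-∈ (T-infixˡ p q n) x∈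

∈ᵀ-right : ∀ {x} p q → x ∈ᵀ T (mediant p q) q → x ∈ᵀ T p q
∈ᵀ-right p q (n , x∈) = suc n , infix-∈ (T-infixʳ p q n) x∈

-- The numerator of `q - p` over the common denominator `↧ p * ↧ q`, before any cancellation.
det : ℚ → ℚ → ℤ
det p q = ↥ q ℤ.* ↧ p ℤ.- ↥ p ℤ.* ↧ q

det-positive : ∀ {p q} → p < q → 0ℤ ℤ.< det p q
det-positive {p} {q} p<q = subst (ℤ._< det p q) (ℤ.+-inverseʳ (↥ p ℤ.* ↧ q))
  (ℤ.+-monoˡ-< (ℤ.- (↥ p ℤ.* ↧ q)) (drop-*<* p<q))

-- The witness `suc g` is the gcd that `_/_` cancels; it is nonzero because the sum of two
-- denominators is positive.
mediant-reduction : ∀ p q → ∃[ g ]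
  (↥ mediant p q ℤ.* +[1+ g ] ≡ ↥ p ℤ.+ ↥ q) × (↧ mediant p q ℤ.* +[1+ g ] ≡ ↧ p ℤ.+ ↧ q)
mediant-reduction p q
  with ℕ.gcd ∣ ↥ p ℤ.+ ↥ q ∣ (↧ₙ p ℕ.+ ↧ₙ q)
     | ℕ.gcd[m,n]≢0 ∣ ↥ p ℤ.+ ↥ q ∣ (↧ₙ p ℕ.+ ↧ₙ q) (inj₂ λ ())
     | ↥-/ (↥ p ℤ.+ ↥ q) (↧ₙ p ℕ.+ ↧ₙ q)
     | ↧-/ (↥ p ℤ.+ ↥ q) (↧ₙ p ℕ.+ ↧ₙ q)
... | zero  | g≢0 | _  | _  = contradiction refl g≢0
... | suc g | _   | eq | eq′ = g , eq , eq′

-- Multiplying by `suc g` cannot shrink `i`, and the positive `j` makes the inequality strict, so no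
-- bound on the cancelled factor enters.
<-from-scaled : ∀ {i j k} g → 0ℤ ℤ.< i → 0ℤ ℤ.< j → i ℤ.* +[1+ g ] ℤ.+ j ≡ k → ∣ i ∣ ℕ.< ∣ k ∣
<-from-scaled {+ i} {+ j} g _ (ℤ.+<+ 0<j) refl = begin-strict
  i                                     ≤⟨ ℕ.m≤m*n i (suc g) ⟩
  i ℕ.* suc g                           <⟨ ℕ.m<m+n (i ℕ.* suc g) 0<j ⟩
  i ℕ.* suc g ℕ.+ j                     ≡⟨ cong (λ k → ∣ k ℤ.+ + j ∣) (ℤ.pos-* i (suc g)) ⟩
  ∣ + i ℤ.* +[1+ g ] ℤ.+ + j ∣          ∎
  where open ℕ.≤-Reasoning

-- `det` is bilinear in the pairs of numerator and denominator and antisymmetric, so at the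
-- unreduced mediant `det x` takes the value `det x q - det p x`.
det-mediantʳ : ∀ {p q x} → p < x → x < mediant p q → ∣ det x (mediant p q) ∣ ℕ.< ∣ det x q ∣
det-mediantʳ {p} {q} {x} p<x x<m with mediant-reduction p q
... | g , num , den = <-from-scaled g (det-positive x<m) (det-positive p<x) (begin
  (↥ m ℤ.* ↧ x ℤ.- ↥ x ℤ.* ↧ m) ℤ.* G ℤ.+ det p x
    ≡⟨ cong (ℤ._+ det p x) (scale (↥ m) (↧ m) (↥ x) (↧ x) G) ⟩
  (↥ m ℤ.* G) ℤ.* ↧ x ℤ.- ↥ x ℤ.* (↧ m ℤ.* G) ℤ.+ det p x
    -- With `G` moved onto its components, the reduced mediant gives way to the plain sums.
    ≡⟨ cong₂ (λ a b → a ℤ.* ↧ x ℤ.- ↥ x ℤ.* b ℤ.+ det p x) num den ⟩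
  (↥ p ℤ.+ ↥ q) ℤ.* ↧ x ℤ.- ↥ x ℤ.* (↧ p ℤ.+ ↧ q) ℤ.+ det p x
    ≡⟨ cancel (↥ p) (↧ p) (↥ q) (↧ q) (↥ x) (↧ x) ⟩
  det x q ∎)
  where
  open ≡-Reasoning
  m = mediant p q
  G = +[1+ g ]
  scale : ∀ a b u v k →
    (a ℤ.* v ℤ.- u ℤ.* b) ℤ.* k ≡ (a ℤ.* k) ℤ.* v ℤ.- u ℤ.* (b ℤ.* k)
  scale = solve-∀
  cancel : ∀ a b c d u v →
    (a ℤ.+ c) ℤ.* v ℤ.- u ℤ.* (b ℤ.+ d) ℤ.+ (u ℤ.* b ℤ.- a ℤ.* v) ≡ c ℤ.* v ℤ.- u ℤ.* d
  cancel = solve-∀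

det-mediantˡ : ∀ {p q x} → mediant p q < x → x < q → ∣ det (mediant p q) x ∣ ℕ.< ∣ det p x ∣
det-mediantˡ {p} {q} {x} m<x x<q with mediant-reduction p q
... | g , num , den = <-from-scaled g (det-positive m<x) (det-positive x<q) (begin
  (↥ x ℤ.* ↧ m ℤ.- ↥ m ℤ.* ↧ x) ℤ.* G ℤ.+ det x q
    ≡⟨ cong (ℤ._+ det x q) (scale (↥ m) (↧ m) (↥ x) (↧ x) G) ⟩
  ↥ x ℤ.* (↧ m ℤ.* G) ℤ.- (↥ m ℤ.* G) ℤ.* ↧ x ℤ.+ det x q
    ≡⟨ cong₂ (λ a b → ↥ x ℤ.* b ℤ.- a ℤ.* ↧ x ℤ.+ det x q) num den ⟩
  ↥ x ℤ.* (↧ p ℤ.+ ↧ q) ℤ.- (↥ p ℤ.+ ↥ q) ℤ.* ↧ x ℤ.+ det x q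
    ≡⟨ cancel (↥ p) (↧ p) (↥ q) (↧ q) (↥ x) (↧ x) ⟩
  det p x ∎)
  where
  open ≡-Reasoning
  m = mediant p q
  G = +[1+ g ]
  scale : ∀ a b u v k →
    (u ℤ.* b ℤ.- a ℤ.* v) ℤ.* k ≡ u ℤ.* (b ℤ.* k) ℤ.- (a ℤ.* k) ℤ.* v
  scale = solve-∀
  cancel : ∀ a b c d u v →
    u ℤ.* (b ℤ.+ d) ℤ.- (a ℤ.+ c) ℤ.* v ℤ.+ (c ℤ.* v ℤ.- u ℤ.* d) ≡ u ℤ.* b ℤ.- a ℤ.* v
  cancel = solve-∀

interior-∈ᵀ : ∀ p q x → p < x → x < q → Acc ℕ._<_ (∣ det p x ∣ ℕ.+ ∣ det x q ∣) → x ∈ᵀ T p q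
interior-∈ᵀ p q x p<x x<q (acc rec) with <-cmp x (mediant p q)
... | tri≈ _ x≡m _ = 1 , there (here x≡m)
-- `det p x` stays fixed while the other summand of the measure drops; the case below is the mirror
-- image.
... | tri< x<m _ _ = ∈ᵀ-left p q (interior-∈ᵀ p (mediant p q) x p<x x<m
  (rec (ℕ.+-monoʳ-< ∣ det p x ∣ (det-mediantʳ {p} {q} {x} p<x x<m))))
... | tri> _ _ m<x = ∈ᵀ-right p q (interior-∈ᵀ (mediant p q) q x m<x x<q
  (rec (ℕ.+-monoˡ-< ∣ det x q ∣ (det-mediantˡ {p} {q} {x} m<x x<q))))

theorem3p7 : (p q : ℚ) → 0ℚ ≤ p → 0ℚ ≤ q → p < q →
    (x : ℚ) → p ≤ x → x ≤ q → x ∈ᵀ T p q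
theorem3p7 p q _ _ _ x p≤x x≤q with <-cmp p x | <-cmp x q
-- An endpoint is already in row 0, so only a strictly interior `x` needs the descent.
... | tri> _ _ x<p | _            = contradiction (<-≤-trans x<p p≤x) (<-irrefl refl)
... | tri≈ _ p≡x _ | _            = 0 , here (sym p≡x)
... | tri< _ _ _   | tri> _ _ q<x = contradiction (<-≤-trans q<x x≤q) (<-irrefl refl)
... | tri< _ _ _   | tri≈ _ x≡q _ = 0 , there (here x≡q)
... | tri< p<x _ _ | tri< x<q _ _ = interior-∈ᵀ p q x p<x x<q (<-wellFounded _)
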